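{- Let $\kappa$ be an uncountable cardinal with $\kappa=\kappa^{<\kappa}$. Assume that $\kappa$ is not weakly compact, and let $A$ be a subset of ${}^\kappa\kappa$ with the $\kappa$-perfect set property. Then the following statements are equivalent. (1) The set $A$ contains a closed subset (of ${}^\kappa\kappa$) homeomorphic to ${}^\kappa\kappa$. (2) The set $A$ is not contained in a $\mathrm{K}_\kappa$ subset of ${}^\kappa\kappa$. (3) The set $A$ has cardinality greater than $\kappa$. In particular, the set $A$ satisfies the strong Hurewicz dichotomy.
   Context: ${}^\kappa\kappa$ is the set of all functions from $\kappa$ to $\kappa$ with the bounded topology, whose basic open sets are $N_s=\{x\in{}^\kappa\kappa \mid s\subseteq x\}$ for $s\in{}^{<\kappa}\kappa$ (functions from an ordinal ${<}\kappa$ into $\kappa$); ${}^\kappa 2$ carries the subspace topology. $A\subseteq{}^\kappa\kappa$ is $\kappa$-compact if every open cover of $A$ has a subcover of size less than $\kappa$, and $\mathrm{K}_\kappa$ if it is a union of $\kappa$-many $\kappa$-compact subsets of ${}^\kappa\kappa$. $A$ has the $\kappa$-perfect set property if either $A$ has cardinality at most $\kappa$, or else $A$ contains a closed subset of ${}^\kappa\kappa$ homeomorphic to ${}^\kappa 2$. $A$ satisfies the strong Hurewicz dichotomy if either $A$ is itself a $\mathrm{K}_\kappa$ subset of ${}^\kappa\kappa$, or else $A$ contains a closed subset of ${}^\kappa\kappa$ homeomorphic to ${}^\kappa\kappa$. -}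

module Defs where

open import Axiom.ExcludedMiddle using (ExcludedMiddle)
open import Axiom.Extensionality.Propositional using (Extensionality)
open import Data.Bool.Base using (Bool)
open import Data.Nat.Base using (ℕ)
open import Data.Product.Base using (Σ; Σ-syntax; ∃; ∃-syntax; _×_; _,_)
open import Data.Refinement.Base using (Refinement; value)
open import Data.Sum.Base using (_⊎_)
open import Function.Base using (_∘_)
open import Function.Bundles using (_⇔_; _↣_; _↔_; module Inverse)
open import Induction.WellFounded using (WellFounded)
open import Level using (Level; Setω; _⊔_) renaming (suc to lsuc)
open import Relation.Binary.Core using (Rel)
open import Relation.Binary.PropositionalEquality.Core using (_≡_)
open import Relation.Binary.Structures using (IsStrictTotalOrder)
open import Relation.Nullary.Negation.Core using (¬_)
open import Relation.Unary using (Pred; _∈_; _⊆_; _≐_; ∁; U; ⋃)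

private
  variable
    ℓ a b p q : Level

-- The part of the set-theoretic (ZFC) background that is not built into Agda.
-- Choice needs no separate clause: deciding an arbitrary type P yields an
-- element of P whenever ¬ ¬ P, so Σ-types and merely existing witnesses
-- can be used interchangeably.
record Classical : Setω where
  field
    excludedMiddle : ∀ {ℓ} → ExcludedMiddle ℓ
    extensionality : ∀ {a b} → Extensionality a b

-- A subset regarded as a type.  Membership proofs are irrelevant in a
-- refinement, so this has exactly one element for each element of the subset.
Subtype : {A : Set a} → Pred A p → Set (a ⊔ p)
Subtype {A = A} P = Refinement A P

infix 4 _≺_

-- Strict comparison of cardinalities; |A| ≤ |B| is A ↣ B.
_≺_ : Set a → Set b → Set (a ⊔ b)
A ≺ B = (A ↣ B) × ¬ (B ↣ A)

-- A cardinal is an initial ordinal, given as the well-ordered set of its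
-- elements: it does not inject into any of its proper initial segments.
record Cardinal ℓ : Set (lsuc ℓ) where
  infix 4 _<_
  field
    Carrier            : Set ℓ
    _<_                : Rel Carrier ℓ
    isStrictTotalOrder : IsStrictTotalOrder _≡_ _<_
    wellFounded        : WellFounded _<_
    initial            : ∀ α → ¬ (Carrier ↣ Subtype (_< α))

module _ (κ : Cardinal ℓ) where
  open Cardinal κ renaming (Carrier to K)

  Uncountable : Set ℓ
  Uncountable = ℕ ≺ K

  -- The ordinal α as the set of its predecessors.
  ↓ : K → Set ℓ
  ↓ α = Subtype (_< α)

  -- ^{<κ}κ
  Sequence : Set ℓ
  Sequence = Σ[ α ∈ K ] (↓ α → K)

  -- κ = κ^{<κ}
  κ≡κ^<κ : Set ℓ
  κ≡κ^<κ = K ↔ Sequence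

  -- κ → (κ)²₂.  A colouring of the two-element subsets of κ is given by its
  -- values c α β for α < β; its other values play no role.
  PartitionProperty : Set (lsuc ℓ)
  PartitionProperty =
    ∀ (c : K → K → Bool) →
    Σ[ H ∈ Pred K ℓ ] (K ↔ Subtype H) ×
      ∃[ i ] (∀ {α β} → α ∈ H → β ∈ H → α < β → c α β ≡ i)

  WeaklyCompact : Set (lsuc ℓ)
  WeaklyCompact = Uncountable × PartitionProperty

  -- ^κκ
  Space : Set ℓ
  Space = K → K

  -- The basic open set N_s of all x extending s.
  N : Sequence → Pred Space ℓ
  N (α , s) x = ∀ (β : ↓ α) → x (value β) ≡ s β

  -- Unions of basic open sets.
  Open : Pred (Pred Space ℓ) ℓ
  Open V = ∀ {x} → x ∈ V → ∃[ s ] x ∈ N s × N s ⊆ V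

  Closed : Pred (Pred Space ℓ) ℓ
  Closed C = Open (∁ C)

  -- The subspace topology on C.
  OpenIn : (C : Pred Space p) → Pred (Pred (Subtype C) ℓ) (lsuc ℓ ⊔ p)
  OpenIn C V =
    Σ[ W ∈ Pred Space ℓ ] Open W × (∀ x → x ∈ V ⇔ value x ∈ W)

  Continuous : (C : Pred Space p) (D : Pred Space q) →
               (Subtype C → Subtype D) → Set (lsuc ℓ ⊔ p ⊔ q)
  Continuous C D f = ∀ V → OpenIn D V → OpenIn C (V ∘ f)

  Homeomorphic : Pred Space p → Pred Space q → Set (lsuc ℓ ⊔ p ⊔ q)
  Homeomorphic C D =
    Σ[ h ∈ Subtype C ↔ Subtype D ]
      Continuous C D (Inverse.to h) × Continuous D C (Inverse.from h)

  -- ^κ2 as a subset of ^κκ.  An ordinal β belongs to 2 = {0, 1} precisely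
  -- when every element of β is 0, i.e. has no predecessor.
  Cantor : Pred Space ℓ
  Cantor x = ∀ α {β} → β < x α → ∀ γ → ¬ γ < β

  ContainsClosedCopyOf : Pred Space p → Pred Space ℓ → Set (lsuc ℓ ⊔ p)
  ContainsClosedCopyOf D A =
    Σ[ C ∈ Pred Space ℓ ] Closed C × C ⊆ A × Homeomorphic C D

  κ-Compact : Pred Space ℓ → Set (lsuc ℓ)
  κ-Compact A =
    ∀ (I : Set ℓ) (V : I → Pred Space ℓ) → (∀ i → Open (V i)) → A ⊆ ⋃ I V →
    Σ[ J ∈ Pred I ℓ ] (Subtype J ≺ K) × A ⊆ (λ x → ∃[ i ] i ∈ J × x ∈ V i)

  Kκ : Pred Space ℓ → Set (lsuc ℓ)
  Kκ A = Σ[ C ∈ (K → Pred Space ℓ) ] (∀ α → κ-Compact (C α)) × A ≐ ⋃ K C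

  PerfectSetProperty : Pred Space ℓ → Set (lsuc ℓ)
  PerfectSetProperty A = (Subtype A ↣ K) ⊎ ContainsClosedCopyOf Cantor A

  StrongHurewiczDichotomy : Pred Space ℓ → Set (lsuc ℓ)
  StrongHurewiczDichotomy A = Kκ A ⊎ ContainsClosedCopyOf U A

{-# OPTIONS --safe #-}

-- The heart of the matter is (3) ⇒ (1), for which ^κκ has to be embedded as a
-- closed subset into ^κ2.  Let c be a colouring of [κ]² without homogeneous set
-- of size κ, and let p α ∈ ^κ2 consist of c(·, α) restricted to α, followed by
-- a 1 at α and by 0 from then on.  If z ∈ ^κ2 agreed with c(·, α) up to δ for
-- some α ≥ δ, for every δ < κ, then one could recursively pick an increasing
-- κ-sequence b such that c(b ξ, b η) = z(b ξ) for ξ < η, and one of the two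
-- fibres of z on its range would be homogeneous.  So the points p α form
-- a closed discrete set of size κ, and y ↦ (p (y α) | α < κ) is a closed
-- embedding of ^κκ into ^κ(^κ2), which is ^κ2 up to re-indexing along
-- κ × κ → κ.  The implication (1) ⇒ (2) is a diagonal argument: every coordinate
-- takes fewer than κ values on a κ-compact set.
module Submission where

open import Defs
open import Axiom.ExcludedMiddle using (ExcludedMiddle)
open import Axiom.Extensionality.Propositional using (Extensionality)
open import Data.Bool.Base using (Bool; true; false)
open import Data.Empty using (⊥-elim)
open import Data.Irrelevant using ([_])
open import Data.Nat.Base using (ℕ)
open import Data.Product.Base using (Σ-syntax; ∃; ∃-syntax; _×_; _,_; proj₁; proj₂)
open import Data.Refinement.Base using (value; _,_)
open import Data.Refinement.Properties using (value-injective)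
open import Data.Sum.Base using (_⊎_; inj₁; inj₂)
open import Data.Unit.Base using (tt)
open import Function.Base using (_∘_; case_of_)
open import Function.Bundles
  using (_⇔_; _↣_; _↔_; mk⇔; mk↣; mk↔ₛ′; module Equivalence; module Injection; module Inverse)
open import Induction.WellFounded using (WfRec; module All; module FixPoint)
open import Level using (Level; _⊔_)
open import Relation.Binary.Definitions using (tri<; tri≈; tri>)
open import Relation.Binary.PropositionalEquality
  using (_≡_; refl; sym; trans; cong; cong₂; subst; subst₂)
open import Relation.Binary.Structures using (IsStrictTotalOrder)
open import Relation.Nullary.Decidable.Core using
  (Dec; yes; no; True; toWitness; fromWitness; decidable-stable; recompute)
open import Relation.Nullary.Negation.Core using (¬_)
open import Relation.Unary using (Pred; _∈_; _⊆_; U)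

module _ (classical : Classical) where

  private
    em : ∀ {ℓ} → ExcludedMiddle ℓ
    em = Classical.excludedMiddle classical

    ext : ∀ {a b} → Extensionality a b
    ext = Classical.extensionality classical

  -- Classical reasoning and membership in subtypes

  byContradiction : ∀ {a} {A : Set a} → ¬ ¬ A → A
  byContradiction = decidable-stable em

  ¬∀⇒∃¬ : ∀ {a b} {A : Set a} {B : A → Set b} → ¬ (∀ x → B x) → ∃ (¬_ ∘ B)
  ¬∀⇒∃¬ h = byContradiction λ n → h λ x → byContradiction λ nb → n (x , nb)

  -- An irrelevantly stored membership proof can be recovered because excluded middle decides
  -- membership.
  ∈-Subtype : ∀ {a p} {A : Set a} {P : Pred A p} (x : Subtype P) → value x ∈ P
  ∈-Subtype (_ , [ p ]) = recompute em p

  module _ {ℓ} (κ : Cardinal ℓ) (uncountable : Uncountable κ) (power : κ≡κ^<κ κ) where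
    open Cardinal κ renaming (Carrier to K)
    open IsStrictTotalOrder isStrictTotalOrder
      using (compare; irrefl; asym) renaming (trans to <-trans)

    private
      ν : ℕ → K
      ν = Injection.to (proj₁ uncountable)

      ν-injective : ∀ {m n} → ν m ≡ ν n → m ≡ n
      ν-injective = Injection.injective (proj₁ uncountable)

      sequence : K → Sequence κ
      sequence = Inverse.to power

      code : Sequence κ → K
      code = Inverse.from power

      sequence-code : ∀ s → sequence (code s) ≡ s
      sequence-code = Inverse.strictlyInverseˡ power

    -- The order of κ

    <-≮-trans : ∀ {α β γ} → α < β → ¬ γ < β → α < γ
    <-≮-trans {α} {β} {γ} α<β γ≮β with compare β γ
    ... | tri< β<γ _ _ = <-trans α<β β<γ
    ... | tri≈ _ refl _ = α<β
    ... | tri> _ _ γ<β = ⊥-elim (γ≮β γ<β)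

    ≮-<-trans : ∀ {α β γ} → ¬ β < α → β < γ → α < γ
    ≮-<-trans {α} {β} {γ} β≮α β<γ with compare α β
    ... | tri< α<β _ _ = <-trans α<β β<γ
    ... | tri≈ _ refl _ = β<γ
    ... | tri> _ _ β<α = ⊥-elim (β≮α β<α)

    ≮∧≢⇒> : ∀ {α β} → ¬ α < β → ¬ α ≡ β → β < α
    ≮∧≢⇒> {α} {β} α≮β α≢β with compare α β
    ... | tri< α<β _ _ = ⊥-elim (α≮β α<β)
    ... | tri≈ _ α≡β _ = ⊥-elim (α≢β α≡β)
    ... | tri> _ _ β<α = β<α

    least : ∀ {P : Pred K ℓ} → ∃ P → ∃[ α ] P α × (∀ {β} → P β → ¬ β < α)
    least {P} (α , Pα) = byContradiction λ none →
      All.wfRec wellFounded ℓ (λ α → ¬ P α)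
        (λ α IH Pα → none (α , Pα , λ Pβ β<α → IH β<α Pβ)) α Pα

    -- Regularity of κ

    evaluate : K → Sequence κ → K
    evaluate β (α , s) with em {P = β < α}
    ... | yes β<α = s (β , [ β<α ])
    -- An arbitrary value at positions beyond the length of the sequence.
    ... | no _ = ν 0

    evaluate-↓ : ∀ {α} (s : ↓ κ α → K) (β : ↓ κ α) → evaluate (value β) (α , s) ≡ s β
    evaluate-↓ {α} s β with em {P = value β < α}
    ... | yes _ = refl
    ... | no β≮α = ⊥-elim (β≮α (∈-Subtype β))

    Small : Pred K ℓ → Set ℓ
    Small P = ¬ (K ↣ Subtype P)

    -- König's diagonal argument. For each β below α some `k` is not the β-th entry of any sequence
    -- coded in `R β`; the sequence of these values has a code outside every `R β`.
    koenig : ∀ {α} (R : ↓ κ α → Pred K ℓ) → (∀ β → Small (R β)) →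
             ∃[ γ ] ∀ β → ¬ R β γ
    koenig {α} R small = code (α , s) , λ β Rβγ → proj₂ (fresh β) (code (α , s)) Rβγ
      (trans (cong (evaluate (value β)) (sequence-code (α , s))) (evaluate-↓ s β))
      where
      fresh : ∀ β → ∃[ k ] ∀ γ → R β γ → ¬ evaluate (value β) (sequence γ) ≡ k
      fresh β = byContradiction λ none →
        let hit : ∀ k → ∃[ γ ] R β γ × evaluate (value β) (sequence γ) ≡ k
            hit k = byContradiction λ n → none (k , λ γ r e → n (γ , r , e))
        -- A code in `R β` chosen for `k` determines `k` as its β-th entry, so κ would inject into
        -- `R β`.
        in small β (mk↣ {to = λ k → proj₁ (hit k) , [ proj₁ (proj₂ (hit k)) ]}
             λ {k} {k′} e → trans (sym (proj₂ (proj₂ (hit k))))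
               (trans (cong (evaluate (value β) ∘ sequence ∘ value) e) (proj₂ (proj₂ (hit k′)))))

      s : ↓ κ α → K
      s β = proj₁ (fresh β)

    pair-small : ∀ α β → Small (λ γ → γ ≡ α ⊎ γ ≡ β)
    pair-small α β f = go (at 0) (at 1) (at 2)
      where
      φ : K → K
      φ = value ∘ Injection.to f

      at : ∀ n → φ (ν n) ≡ α ⊎ φ (ν n) ≡ β
      at n = ∈-Subtype (Injection.to f (ν n))

      same : ∀ {m n γ} → φ (ν m) ≡ γ → φ (ν n) ≡ γ → m ≡ n
      same p q = ν-injective (Injection.injective f (value-injective (trans p (sym q))))

      go : φ (ν 0) ≡ α ⊎ φ (ν 0) ≡ β → φ (ν 1) ≡ α ⊎ φ (ν 1) ≡ β →
           ¬ (φ (ν 2) ≡ α ⊎ φ (ν 2) ≡ β)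
      go (inj₁ p) (inj₁ q) _        = case same p q of λ ()
      go (inj₂ p) (inj₂ q) _        = case same p q of λ ()
      go (inj₁ p) (inj₂ q) (inj₁ r) = case same p r of λ ()
      go (inj₁ p) (inj₂ q) (inj₂ r) = case same q r of λ ()
      go (inj₂ p) (inj₁ q) (inj₁ r) = case same q r of λ ()
      go (inj₂ p) (inj₁ q) (inj₂ r) = case same p r of λ ()

    -- If α were the greatest element, then κ would be covered by
    -- the sets {β, α} for β < α.
    no-greatest : ∀ α → ∃[ β ] α < β
    no-greatest α = byContradiction λ none →
      let γ , γ∉ = koenig {α} (λ β γ → γ ≡ value β ⊎ γ ≡ α) (λ β → pair-small (value β) α)
          below : ∀ {β} → ¬ β ≡ α → β < α
          below {β} β≢α = ≮∧≢⇒> (λ α<β → none (β , α<β)) (β≢α ∘ sym)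
      in case em {P = γ ≡ α} of λ where
           (no γ≢α) → γ∉ (γ , [ below γ≢α ]) (inj₁ refl)
           (yes γ≡α) → case em {P = ν 0 ≡ α} of λ where
             (no ν0≢α) → γ∉ (ν 0 , [ below ν0≢α ]) (inj₂ γ≡α)
             (yes ν0≡α) → γ∉ (ν 1 , [ below (λ ν1≡α →
               case ν-injective (trans ν0≡α (sym ν1≡α)) of λ ()) ]) (inj₂ γ≡α)

    -- Initial segments are small because κ is initial. So some γ lies below none of the values of
    -- `f`, and anything greater than γ bounds them strictly.
    bounded : ∀ {α} (f : ↓ κ α → K) → ∃[ δ ] ∀ β → f β < δ
    bounded f =
      let γ , γ≮ = koenig (λ β → _< f β) (λ β → initial (f β))
          δ , γ<δ = no-greatest γ
      in δ , λ β → ≮-<-trans (γ≮ β) γ<δ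

    bounded-below : ∀ (f : K → K) α → ∃[ δ ] (∀ {β} → β < α → f β < δ)
    bounded-below f α =
      let δ , f<δ = bounded {α} (f ∘ value) in δ , λ β<α → f<δ (_ , [ β<α ])

    above-both : ∀ α β → ∃[ γ ] α < γ × β < γ
    above-both α β with compare α β | no-greatest α | no-greatest β
    ... | tri< α<β _ _ | _ | γ , β<γ = γ , <-trans α<β β<γ , β<γ
    ... | tri≈ _ refl _ | γ , α<γ | _ = γ , α<γ , α<γ
    ... | tri> _ _ β<α | γ , α<γ | _ = γ , α<γ , <-trans β<α α<γ

    abstract
      supremum : ∀ {α} (f : ↓ κ α → K) →
                 ∃[ δ ] (∀ β → f β < δ) × (∀ {γ} → (∀ β → f β < γ) → ¬ γ < δ)
      supremum f = least (bounded f)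

    -- Increasing sequences of length κ

    module Increasing (g : K → K) (g-inflationary : ∀ δ → ¬ g δ < δ) where

      private
        -- By regularity the earlier values always have a least strict upper bound, so the recursion
        -- runs through all of κ; as `g` never falls below its argument, the values increase
        -- strictly.
        step : ∀ α → WfRec _<_ (λ _ → K) α → K
        step α IH = g (proj₁ (supremum {α} λ β → IH (∈-Subtype β)))

        step-ext : ∀ α {IH IH′ : WfRec _<_ (λ _ → K) α} →
                   (∀ {β} (β<α : β < α) → IH β<α ≡ IH′ β<α) → step α IH ≡ step α IH′
        step-ext α eq = cong (λ f → g (proj₁ (supremum {α} f))) (ext λ β → eq (∈-Subtype β))

      abstract
        b : K → K
        b = All.wfRec wellFounded ℓ (λ _ → K) step

        sup : K → K
        sup α = proj₁ (supremum {α} (b ∘ value))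

        b-unfold : ∀ α → b α ≡ g (sup α)
        b-unfold α = FixPoint.unfold-wfRec wellFounded (λ _ → K) step step-ext

        b<sup : ∀ {α β} → β < α → b β < sup α
        b<sup {α} β<α = proj₁ (proj₂ (supremum {α} (b ∘ value))) (_ , [ β<α ])

        sup-least : ∀ {α γ} → (∀ β → β < α → b β < γ) → ¬ γ < sup α
        sup-least {α} h = proj₂ (proj₂ (supremum {α} (b ∘ value))) λ β → h _ (∈-Subtype β)

      b-increasing : ∀ {α β} → β < α → b β < b α
      b-increasing {α} β<α =
        <-≮-trans (b<sup β<α) (subst (λ γ → ¬ γ < sup α) (sym (b-unfold α)) (g-inflationary _))

      b-injective : ∀ {α β} → b α ≡ b β → α ≡ β
      b-injective {α} {β} e with compare α β
      ... | tri< α<β _ _ = ⊥-elim (irrefl e (b-increasing α<β))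
      ... | tri≈ _ α≡β _ = α≡β
      ... | tri> _ _ β<α = ⊥-elim (irrefl (sym e) (b-increasing β<α))

      b-reflects-< : ∀ {α β} → b α < b β → α < β
      b-reflects-< {α} {β} bα<bβ with compare α β
      ... | tri< α<β _ _ = α<β
      ... | tri≈ _ refl _ = ⊥-elim (irrefl refl bα<bβ)
      ... | tri> _ _ β<α = ⊥-elim (asym bα<bβ (b-increasing β<α))

      b-unbounded : ∀ δ → ∃[ ξ ] ¬ b ξ < δ
      b-unbounded δ = ¬∀⇒∃¬ λ b<δ →
        initial δ (mk↣ {to = λ ξ → b ξ , [ b<δ ξ ]} (b-injective ∘ cong value))

    Unbounded : Pred K ℓ → Set ℓ
    Unbounded H = ∀ δ → ∃[ η ] η ∈ H × ¬ η < δ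

    -- Always taking the least element of `H` not below the supremum so far enumerates `H` in
    -- increasing order.
    unbounded⇒↔ : ∀ {H : Pred K ℓ} → Unbounded H → K ↔ Subtype H
    unbounded⇒↔ {H} unbounded =
      mk↔ₛ′ to from (λ η → value-injective (b-from η)) (λ α → b-injective (b-from (to α)))
      where
      next : ∀ δ → ∃[ η ] (η ∈ H × ¬ η < δ) × (∀ {θ} → θ ∈ H × ¬ θ < δ → ¬ θ < η)
      next δ = least (unbounded δ)

      open Increasing (proj₁ ∘ next) (λ δ → proj₂ (proj₁ (proj₂ (next δ))))

      b∈H : ∀ α → b α ∈ H
      b∈H α = subst H (sym (b-unfold α)) (proj₁ (proj₁ (proj₂ (next (sup α)))))

      -- A missed η would remain a candidate at every stage, so by induction all `b α` would stay
      -- below it, injecting κ into the initial segment of η.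
      b-surjective : ∀ {η} → η ∈ H → ∃[ α ] b α ≡ η
      b-surjective {η} η∈H = byContradiction λ missed →
        let b<η : ∀ α → b α < η
            b<η = All.wfRec wellFounded ℓ (λ α → b α < η) λ α IH →
              ≮∧≢⇒> (subst (λ γ → ¬ η < γ) (sym (b-unfold α))
                       (proj₂ (proj₂ (next (sup α))) (η∈H , sup-least λ _ → IH)))
                    (λ e → missed (α , sym e))
        in initial η (mk↣ {to = λ α → b α , [ b<η α ]} (b-injective ∘ cong value))

      to : K → Subtype H
      to α = b α , [ b∈H α ]

      from : Subtype H → K
      from η = proj₁ (b-surjective (∈-Subtype η))

      b-from : ∀ η → b (from η) ≡ value η
      b-from η = proj₂ (b-surjective (∈-Subtype η))

    -- Agreement on initial segments

    infix 4 _≈[_]_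

    _≈[_]_ : ∀ {a} {A : Set a} → (K → A) → K → (K → A) → Set (ℓ ⊔ a)
    x ≈[ δ ] y = ∀ {β} → β < δ → x β ≡ y β

    ≈-trans : ∀ {a} {A : Set a} {x y z : K → A} {δ} → x ≈[ δ ] y → y ≈[ δ ] z → x ≈[ δ ] z
    ≈-trans x≈y y≈z β<δ = trans (x≈y β<δ) (y≈z β<δ)

    ≈-mono : ∀ {a} {A : Set a} {x y : K → A} {γ δ} → γ < δ → x ≈[ δ ] y → x ≈[ γ ] y
    ≈-mono γ<δ x≈y β<γ = x≈y (<-trans β<γ γ<δ)

    -- A closed discrete subset of ^κ2 of size κ

    Homogeneous : (K → K → Bool) → Bool → Pred K ℓ → Set ℓ
    Homogeneous c i H = ∀ {α β} → α ∈ H → β ∈ H → α < β → c α β ≡ i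

    module _ (c : K → K → Bool)
             (no-homogeneous : ∀ H → K ↔ Subtype H → ∀ i → ¬ Homogeneous c i H) where

      agreement-bounded : ∀ z → ∃[ δ ] ∀ {α} → ¬ α < δ → ¬ (λ ξ → c ξ α) ≈[ δ ] z
      agreement-bounded z = byContradiction λ none → absurd λ δ →
        byContradiction λ n → none (δ , λ {α} α≮δ agree → n (α , α≮δ , agree))
        where
        absurd : ¬ (∀ δ → ∃[ α ] ¬ α < δ × (λ ξ → c ξ α) ≈[ δ ] z)
        absurd cofinal = case em {P = Unbounded (H false)} of λ where
            (yes unbounded) → no-homogeneous _ (unbounded⇒↔ unbounded) false homogeneous
            (no ¬unbounded) → no-homogeneous _ (unbounded⇒↔ (true-unbounded ¬unbounded)) true homogeneous
          where
          -- Here `g δ` is some α not below δ whose column `c · α` agrees with `z` below δ.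
          open Increasing (proj₁ ∘ cofinal) (λ δ → proj₁ (proj₂ (cofinal δ)))

          H : Bool → Pred K ℓ
          H i ζ = z ζ ≡ i × ∃[ ξ ] ζ ≡ b ξ

          -- The column of `b η` agrees with `z` below `sup η`, and `b ξ` lies below `sup η`.
          c-b : ∀ {ξ η} → ξ < η → c (b ξ) (b η) ≡ z (b ξ)
          c-b {ξ} {η} ξ<η = trans (cong (c (b ξ)) (b-unfold η))
            (proj₂ (proj₂ (cofinal (sup η))) (b<sup ξ<η))

          homogeneous : ∀ {i} → Homogeneous c i (H i)
          homogeneous (zα , _ , refl) (_ , _ , refl) α<β = trans (c-b (b-reflects-< α<β)) zα

          -- The range of `b` is unbounded, and beyond a bound `δ₀` for the fibre over `false` all
          -- its elements lie in the fibre over `true`.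
          true-unbounded : ¬ Unbounded (H false) → Unbounded (H true)
          true-unbounded ¬unbounded δ =
            let δ₀ , none = ¬∀⇒∃¬ ¬unbounded
                μ , δ<μ , δ₀<μ = above-both δ δ₀
                ξ , bξ≮μ = b-unbounded μ
                μ≮ : ∀ {γ} → γ < μ → ¬ b ξ < γ
                μ≮ γ<μ bξ<γ = bξ≮μ (<-trans bξ<γ γ<μ)
                value-of : ∀ i → z (b ξ) ≡ i → z (b ξ) ≡ true
                value-of = λ where
                  true e → e
                  false e → ⊥-elim (none (b ξ , (e , ξ , refl) , μ≮ δ₀<μ))
            in b ξ , (value-of _ refl , ξ , refl) , μ≮ δ<μ

      point : K → K → Bool
      point α ξ with compare ξ α
      ... | tri< _ _ _ = c ξ α
      ... | tri≈ _ _ _ = true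
      ... | tri> _ _ _ = false

      point-< : ∀ {α ξ} → ξ < α → point α ξ ≡ c ξ α
      point-< {α} {ξ} ξ<α with compare ξ α
      ... | tri< _ _ _ = refl
      ... | tri≈ ξ≮α _ _ = ⊥-elim (ξ≮α ξ<α)
      ... | tri> ξ≮α _ _ = ⊥-elim (ξ≮α ξ<α)

      point-self : ∀ α → point α α ≡ true
      point-self α with compare α α
      ... | tri< _ α≢α _ = ⊥-elim (α≢α refl)
      ... | tri≈ _ _ _ = refl
      ... | tri> _ α≢α _ = ⊥-elim (α≢α refl)

      point-> : ∀ {α ξ} → α < ξ → point α ξ ≡ false
      point-> {α} {ξ} α<ξ with compare ξ α
      ... | tri< _ _ α≮ξ = ⊥-elim (α≮ξ α<ξ)
      ... | tri≈ _ _ α≮ξ = ⊥-elim (α≮ξ α<ξ)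
      ... | tri> _ _ _ = refl

      -- The index is the position of the last `true`.
      point-injective : ∀ {α β} → (∀ ξ → point α ξ ≡ point β ξ) → α ≡ β
      point-injective {α} {β} e with compare α β
      ... | tri< α<β _ _ = case trans (sym (point-self β)) (trans (sym (e β)) (point-> α<β)) of λ ()
      ... | tri≈ _ α≡β _ = α≡β
      ... | tri> _ _ β<α = case trans (sym (point-self α)) (trans (e α) (point-> β<α)) of λ ()

      -- Points with index at least `δ₀` already disagree with `z` below `δ₀`. The remaining ones
      -- are fewer than κ many, so by regularity one δ lies beyond all their separating coordinates.
      points-closed-discrete : ∀ z → ∃[ δ ] ∀ {α} → point α ≈[ δ ] z → ∀ ξ → point α ξ ≡ z ξ
      points-closed-discrete z =
        let δ₀ , disagree = agreement-bounded z
            δ₁ , separator<δ₁ = bounded-below (proj₁ ∘ separator) δ₀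
            δ , δ₀<δ , δ₁<δ = above-both δ₀ δ₁
        in δ , λ {α} agree → case em {P = α < δ₀} of λ where
             (yes α<δ₀) → proj₂ (separator α) (agree (<-trans (separator<δ₁ α<δ₀) δ₁<δ))
             (no α≮δ₀) → ⊥-elim (disagree α≮δ₀ λ ξ<δ₀ →
               trans (sym (point-< (<-≮-trans ξ<δ₀ α≮δ₀))) (agree (<-trans ξ<δ₀ δ₀<δ)))
        where
        -- A coordinate where `point α` and `z` differ, if there is one; otherwise any coordinate
        -- will do.
        separator : ∀ α → ∃[ ξ ] (point α ξ ≡ z ξ → ∀ ξ′ → point α ξ′ ≡ z ξ′)
        separator α = byContradiction λ none → none (ν 0 , λ _ ξ → byContradiction λ ne →
          none (ξ , λ e → ⊥-elim (ne e)))

    -- ^κ(^κ2) inside ^κκ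

    abstract
      -- The least element and its successor. The last component is the form in which `Cantor`
      -- expresses membership in 2.
      bits : ∃[ 0# ] ∃[ 1# ] (0# < 1#) × (∀ {β} → β < 1# → ∀ γ → ¬ γ < β)
      bits =
        let 0# , _ , minimal = least {λ α → α ≡ α} (ν 0 , refl)
            1# , 0<1 , below = least (no-greatest 0#)
        in 0# , 1# , 0<1 , λ β<1 γ γ<β → below (≮-<-trans (minimal refl) γ<β) β<1

    0# 1# : K
    0# = proj₁ bits
    1# = proj₁ (proj₂ bits)

    bit : Bool → K
    bit false = 0#
    bit true  = 1#

    bit∈2 : ∀ i {β} → β < bit i → ∀ γ → ¬ γ < β
    bit∈2 false β<0 = proj₂ (proj₂ (proj₂ bits)) (<-trans β<0 (proj₁ (proj₂ (proj₂ bits))))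
    bit∈2 true = proj₂ (proj₂ (proj₂ bits))

    0≢1 : ¬ 0# ≡ 1#
    0≢1 e = irrefl e (proj₁ (proj₂ (proj₂ bits)))

    select : ∀ {a} {A : Set a} → K → A → A → A
    select k x y with em {P = k ≡ 0#}
    ... | yes _ = x
    ... | no _ = y

    select-0 : ∀ {a} {A : Set a} {x y : A} → select 0# x y ≡ x
    select-0 with em {P = 0# ≡ 0#}
    ... | yes _ = refl
    ... | no 0≢0 = ⊥-elim (0≢0 refl)

    select-1 : ∀ {a} {A : Set a} {x y : A} → select 1# x y ≡ y
    select-1 with em {P = 1# ≡ 0#}
    ... | yes 1≡0 = ⊥-elim (0≢1 (sym 1≡0))
    ... | no _ = refl

    unbit : K → Bool
    unbit k = select k false true

    unbit-bit : ∀ i → unbit (bit i) ≡ i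
    unbit-bit false = select-0
    unbit-bit true = select-1

    bit-injective : ∀ {i j} → bit i ≡ bit j → i ≡ j
    bit-injective {i} {j} e = trans (sym (unbit-bit i)) (trans (cong unbit e) (unbit-bit j))

    abstract
      -- A pair is coded as a sequence with its components at positions `0#` and `1#`. The
      -- projections are total but only left inverse to `pair`: not every ζ need be a pair.
      fst snd : K → K
      fst ζ = evaluate 0# (sequence ζ)
      snd ζ = evaluate 1# (sequence ζ)

      pair : K → K → K
      pair α ξ = code (proj₁ (above-both 0# 1#) , λ β → select (value β) α ξ)

      fst-pair : ∀ α ξ → fst (pair α ξ) ≡ α
      fst-pair α ξ = trans (cong (evaluate 0#) (sequence-code _))
        (trans (evaluate-↓ _ (0# , [ proj₁ (proj₂ (above-both 0# 1#)) ])) select-0)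

      snd-pair : ∀ α ξ → snd (pair α ξ) ≡ ξ
      snd-pair α ξ = trans (cong (evaluate 1#) (sequence-code _))
        (trans (evaluate-↓ _ (1# , [ proj₂ (proj₂ (above-both 0# 1#)) ])) select-1)

    -- Open and Closed in terms of initial segments

    open⇒local : ∀ {V} → Open κ V → ∀ {x} → x ∈ V → ∃[ δ ] ∀ {y} → x ≈[ δ ] y → y ∈ V
    open⇒local open-V x∈V =
      let (δ , s) , x∈N , N⊆V = open-V x∈V
      in δ , λ x≈y → N⊆V λ β → trans (sym (x≈y (∈-Subtype β))) (x∈N β)

    local⇒open : ∀ {V} → (∀ {x} → x ∈ V → ∃[ δ ] ∀ {y} → x ≈[ δ ] y → y ∈ V) → Open κ V
    local⇒open local {x} x∈V =
      let δ , ⊆V = local x∈V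
      in (δ , x ∘ value) , (λ _ → refl) , λ y∈N → ⊆V λ β<δ → sym (y∈N (_ , [ β<δ ]))

    LimitClosed : Pred (Space κ) ℓ → Set ℓ
    LimitClosed C = ∀ x → (∀ δ → ∃[ y ] y ∈ C × x ≈[ δ ] y) → x ∈ C

    closed⇒limitClosed : ∀ {C} → Closed κ C → LimitClosed C
    closed⇒limitClosed closed x limit = byContradiction λ x∉C →
      let δ , ⊆∁C = open⇒local closed x∉C
          y , y∈C , x≈y = limit δ
      in ⊆∁C x≈y y∈C

    limitClosed⇒closed : ∀ {C} → LimitClosed C → Closed κ C
    limitClosed⇒closed limitClosed = local⇒open λ {x} x∉C → byContradiction λ none →
      x∉C (limitClosed x λ δ → byContradiction λ n → none (δ , λ {y} x≈y y∈C → n (y , y∈C , x≈y)))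

    -- Continuity in ε-δ form, with initial segments in place of balls.
    LocallyDetermined : ∀ {p q} (C : Pred (Space κ) p) (D : Pred (Space κ) q) →
                        (Subtype C → Subtype D) → Set (ℓ ⊔ p)
    LocallyDetermined C D f =
      ∀ x δ → ∃[ ε ] ∀ x′ → value x ≈[ ε ] value x′ → value (f x) ≈[ δ ] value (f x′)

    continuous⇒locallyDetermined :
      ∀ {p q} (C : Pred (Space κ) p) (D : Pred (Space κ) q) {f} →
      Continuous κ C D f → LocallyDetermined C D f
    continuous⇒locallyDetermined C D {f} continuous x δ =
      let W , open-W , V⇔W = continuous (λ y → value (f x) ≈[ δ ] value y)
            ( (λ y → value (f x) ≈[ δ ] y)
            , local⇒open (λ x≈y → δ , ≈-trans x≈y)
            , λ _ → mk⇔ (λ v → v) (λ v → v) )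
          ε , ⊆W = open⇒local open-W (Equivalence.to (V⇔W x) (λ _ → refl))
      in ε , λ x′ x≈x′ → Equivalence.from (V⇔W x′) (⊆W x≈x′)

    -- The open set witnessing that the preimage is relatively open is the union of all basic open
    -- sets whose trace on `C` is mapped into `V`.
    locallyDetermined⇒continuous :
      ∀ {p q} (C : Pred (Space κ) p) (D : Pred (Space κ) q) {f} →
      LocallyDetermined C D f → Continuous κ C D f
    locallyDetermined⇒continuous C D {f} determined V (W , open-W , V⇔W) =
      W′ , local⇒open W′-local , λ x → mk⇔ (V⇒W′ x) (W′⇒V x)
      where
      -- Membership in C enters through True, since C need not live in Set ℓ.
      W′ : Pred (Space κ) ℓ
      W′ y = ∃[ ε ] ∀ x (x∈C : True (em {P = x ∈ C})) → y ≈[ ε ] x → V (f (x , [ toWitness x∈C ]))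

      W′-local : ∀ {x} → x ∈ W′ → ∃[ δ ] ∀ {y} → x ≈[ δ ] y → y ∈ W′
      W′-local (ε , ⊆V) = ε , λ x≈y → ε , λ x′ x′∈C y≈x′ → ⊆V x′ x′∈C (≈-trans x≈y y≈x′)

      V⇒W′ : ∀ x → V (f x) → value x ∈ W′
      V⇒W′ x fx∈V =
        let δ , ⊆W = open⇒local open-W (Equivalence.to (V⇔W (f x)) fx∈V)
            ε , fx≈ = determined x δ
        in ε , λ x′ x′∈C x≈x′ → Equivalence.from (V⇔W _) (⊆W (fx≈ (x′ , [ toWitness x′∈C ]) x≈x′))

      W′⇒V : ∀ x → value x ∈ W′ → V (f x)
      W′⇒V x (ε , ⊆V) = ⊆V (value x) (fromWitness (∈-Subtype x)) λ _ → refl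

    -- Transfer of closed copies along closed embeddings

    record ClosedEmbedding {q} (D : Pred (Space κ) q) : Set (ℓ ⊔ q) where
      field
        embed      : Space κ → Subtype D
        continuous : ∀ y δ → ∃[ ε ] ∀ y′ → y ≈[ ε ] y′ → value (embed y) ≈[ δ ] value (embed y′)
        -- This gives injectivity as well as continuity of the inverse on the image.
        reflecting : ∀ y δ → ∃[ ε ] ∀ y′ → value (embed y) ≈[ ε ] value (embed y′) → y ≈[ δ ] y′
        closed     : ∀ z → (∀ δ → ∃[ y ] z ≈[ δ ] value (embed y)) → ∃[ y ] z ≡ value (embed y)

    -- The copy is the image of ^κκ under the embedding followed by the inverse of `h`.
    closedEmbedding⇒copy : ∀ {q} {D : Pred (Space κ) q} → ClosedEmbedding D →
      ∀ {A} → ContainsClosedCopyOf κ D A → ContainsClosedCopyOf κ U A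
    closedEmbedding⇒copy {D = D} E (C , closed-C , C⊆A , h , h-continuous , h⁻¹-continuous) =
      Image , limitClosed⇒closed image-closed
            , (λ { (y , refl) → C⊆A (∈-Subtype (φ y)) })
            , mk↔ₛ′ to from to-from from-to
            , locallyDetermined⇒continuous Image U to-determined
            , locallyDetermined⇒continuous U Image from-determined
      where
      open ClosedEmbedding E

      φ : Space κ → Subtype C
      φ y = Inverse.from h (embed y)

      h-φ : ∀ y → value (Inverse.to h (φ y)) ≡ value (embed y)
      h-φ y = cong value (Inverse.strictlyInverseˡ h (embed y))

      h-determined : LocallyDetermined C D (Inverse.to h)
      h-determined = continuous⇒locallyDetermined C D h-continuous

      φ-injective : ∀ {y y′} → value (φ y) ≡ value (φ y′) → y ≡ y′
      φ-injective {y} {y′} e = ext λ β →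
        let δ , β<δ = no-greatest β
            ε , y≈ = reflecting y δ
        in y≈ y′ (λ {γ} _ → cong (λ x → x γ) (trans (sym (h-φ y))
             (trans (cong (value ∘ Inverse.to h) (value-injective e)) (h-φ y′)))) β<δ

      Image : Pred (Space κ) ℓ
      Image x = ∃[ y ] x ≡ value (φ y)

      image-closed : LimitClosed Image
      image-closed x limit =
        -- The limit must first be placed in `C`; only then can `h` carry the approximations over to
        -- `D`, where the embedding has closed range.
        let x∈C = closed⇒limitClosed closed-C x λ δ →
              let y′ , (y , y′≡φy) , x≈y′ = limit δ
              in y′ , subst C (sym y′≡φy) (∈-Subtype (φ y)) , x≈y′
            x̂ = x , [ x∈C ]
            y , hx≡Ey = closed (value (Inverse.to h x̂)) λ δ →
              let ε , hx≈ = h-determined x̂ δ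
                  y′ , (y , y′≡φy) , x≈y′ = limit ε
              in y , subst (value (Inverse.to h x̂) ≈[ δ ]_) (h-φ y)
                   (hx≈ (φ y) (subst (x ≈[ ε ]_) y′≡φy x≈y′))
        in y , cong value (trans (sym (Inverse.strictlyInverseʳ h x̂))
                 (cong (Inverse.from h) (value-injective hx≡Ey)))

      to : Subtype Image → Subtype U
      to x = proj₁ (∈-Subtype x) , [ tt ]

      φ-to : ∀ x → value x ≡ value (φ (value (to x)))
      φ-to x = proj₂ (∈-Subtype x)

      from : Subtype U → Subtype Image
      from (y , _) = value (φ y) , [ y , refl ]

      to-from : ∀ y → to (from y) ≡ y
      to-from y = value-injective (φ-injective (sym (φ-to (from y))))

      from-to : ∀ x → from (to x) ≡ x
      from-to x = value-injective (sym (φ-to x))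

      to-determined : LocallyDetermined Image U to
      to-determined x δ =
        let ε , y≈ = reflecting (value (to x)) δ
            ε′ , hx≈ = h-determined (φ (value (to x))) ε
        in ε′ , λ x′ x≈x′ → y≈ (value (to x′)) (subst₂ _≈[ ε ]_ (h-φ _) (h-φ _)
             (hx≈ (φ (value (to x′))) (subst₂ _≈[ ε′ ]_ (φ-to x) (φ-to x′) x≈x′)))

      from-determined : LocallyDetermined U Image from
      from-determined (y , _) δ =
        let ε , φ≈ = continuous⇒locallyDetermined D C h⁻¹-continuous (embed y) δ
            ε′ , E≈ = continuous y ε
        in ε′ , λ y′ y≈y′ → φ≈ (embed (value y′)) (E≈ (value y′) y≈y′)

    -- The closed embedding of ^κκ into ^κ2

    cantor-closedEmbedding :
      (c : K → K → Bool) → (∀ H → K ↔ Subtype H → ∀ i → ¬ Homogeneous c i H) →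
      ClosedEmbedding (Cantor κ)
    cantor-closedEmbedding c no-homogeneous = record
      { embed = λ y → E y , [ (λ ζ → bit∈2 (p (y (fst ζ)) (snd ζ))) ]
      ; continuous = λ y δ →
          let ε , fst<ε = bounded-below fst δ
          in ε , λ y′ y≈y′ {ζ} ζ<δ → cong (λ α → bit (p α (snd ζ))) (y≈y′ (fst<ε ζ<δ))
      ; reflecting = λ y δ →
          let ε , bound<ε = bounded-below (λ α → proj₁ (coordinate-bound α (p (y α)))) δ
          -- Discreteness: the point `p (y α)` is isolated, so sufficient agreement on row α forces
          -- `p (y′ α)` to equal it.
          in ε , λ y′ Ey≈Ey′ {α} α<δ → sym (point-injective c no-homogeneous
               (proj₂ (coordinate-bound α (p (y α))) λ {ξ} pair<bound →
                 bit-injective (trans (sym (E-pair y′ α ξ))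
                   (trans (sym (Ey≈Ey′ (<-trans pair<bound (bound<ε α<δ)))) (E-pair y α ξ)))))
      ; closed = E-closed
      }
      where
      p : K → K → Bool
      p = point c no-homogeneous

      E : Space κ → Space κ
      E y ζ = bit (p (y (fst ζ)) (snd ζ))

      E-pair : ∀ y α ξ → E y (pair α ξ) ≡ bit (p (y α) ξ)
      E-pair y α ξ = cong₂ (λ β η → bit (p (y β) η)) (fst-pair α ξ) (snd-pair α ξ)

      -- By regularity the codes `pair α ξ`, for ξ below the isolating bound of `z`, have a common
      -- bound.
      coordinate-bound : ∀ α z → ∃[ ε ] ∀ {β} →
        (∀ {ξ} → pair α ξ < ε → p β ξ ≡ z ξ) → ∀ ξ → p β ξ ≡ z ξ
      coordinate-bound α z =
        let δ , isolated = points-closed-discrete c no-homogeneous z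
            ε , pair<ε = bounded-below (pair α) δ
        in ε , λ agree → isolated λ ξ<δ → agree (pair<ε ξ<δ)

      -- Row α of `z` is approximated by points and hence is a point. Its index `y α` is read off
      -- from an approximation valid up to `bound α`.
      E-closed : ∀ z → (∀ δ → ∃[ y ] z ≈[ δ ] E y) → ∃[ y ] z ≡ E y
      E-closed z limit = y , ext λ ζ →
        -- As ζ need not be a pair and `z ζ` is not known to be a bit, `z` is compared at ζ with an
        -- approximation `y′` valid beyond both ζ and the bound of its row.
        let ε , bound<ε , ζ<ε = above-both (bound (fst ζ)) ζ
            y′ , z≈Ey′ = limit ε
            y′≡y = point-injective c no-homogeneous λ ξ →
              trans (determined y′ (≈-mono bound<ε z≈Ey′) ξ) (sym (y-coordinate (fst ζ) ξ))
        in trans (z≈Ey′ ζ<ε) (cong (λ α → bit (p α (snd ζ))) y′≡y)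
        where
        z[_] : K → K → Bool
        z[ α ] ξ = unbit (z (pair α ξ))

        bound : K → K
        bound α = proj₁ (coordinate-bound α z[ α ])

        determined : ∀ {α} y → z ≈[ bound α ] E y → ∀ ξ → p (y α) ξ ≡ z[ α ] ξ
        determined {α} y z≈Ey = proj₂ (coordinate-bound α z[ α ]) λ {ξ} pair<bound →
          trans (sym (unbit-bit _)) (cong unbit (trans (sym (E-pair y α ξ)) (sym (z≈Ey pair<bound))))

        y : Space κ
        y α = proj₁ (limit (bound α)) α

        y-coordinate : ∀ α ξ → p (y α) ξ ≡ z[ α ] ξ
        y-coordinate α = determined (proj₁ (limit (bound α))) (proj₂ (limit (bound α)))

    -- Kκ sets

    subsingleton-κ-compact : ∀ {B : Pred (Space κ) ℓ} →
      (∀ {x y} → x ∈ B → y ∈ B → x ≡ y) → κ-Compact κ B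
    subsingleton-κ-compact {B} unique I V open-V B⊆V =
      J , (mk↣ {to = λ _ → 0#} (λ {i} {j} _ → J-unique i j) , ¬K↣J) , covered
      where
      -- Different elements of `B` may yield different indices, so a single decision is fixed to
      -- give `J` at most one element.
      chosen : Dec (∃ B)
      chosen = em

      index : ∃ B → I
      index (_ , x∈B) = proj₁ (B⊆V x∈B)

      J : Pred I ℓ
      J i = Σ[ e ∈ ∃ B ] chosen ≡ yes e × i ≡ index e

      J-unique : ∀ (i j : Subtype J) → i ≡ j
      J-unique i j with ∈-Subtype i | ∈-Subtype j
      ... | e , p , i≡ | e′ , q , j≡ with trans (sym p) q
      ... | refl = value-injective (trans i≡ (sym j≡))

      ¬K↣J : ¬ (K ↣ Subtype J)
      ¬K↣J f = 0≢1 (Injection.injective f (J-unique _ _))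

      covered : B ⊆ (λ x → ∃[ i ] i ∈ J × x ∈ V i)
      covered {x} x∈B = go chosen refl
        where
        go : ∀ d → chosen ≡ d → ∃[ i ] i ∈ J × x ∈ V i
        go (no none) _ = ⊥-elim (none (x , x∈B))
        go (yes e@(_ , y∈B)) eq =
          index e , (e , eq , refl) , subst (V (index e)) (unique y∈B x∈B) (proj₂ (B⊆V y∈B))

    -- `A` is the union of the κ many fibres of the injection, each with at most one point.
    ≤κ⇒Kκ : ∀ {A : Pred (Space κ) ℓ} → Subtype A ↣ K → Kκ κ A
    ≤κ⇒Kκ {A} f = Fibre
      , (λ α → subsingleton-κ-compact λ (_ , p) (_ , q) →
          cong value (Injection.injective f (trans p (sym q))))
      , (λ x∈A → _ , x∈A , refl) , λ (_ , x∈A , _) → x∈A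
      where
      Fibre : K → Pred (Space κ) ℓ
      Fibre α x = Σ[ x∈A ∈ x ∈ A ] Injection.to f (x , [ x∈A ]) ≡ α

    -- For each α, `y α` avoids the fewer than κ values indexing the subcover of `Part α`. The
    -- preimage of `y` in `C` would nevertheless lie in some `Part α`.
    copy⇒¬⊆Kκ : ∀ {A : Pred (Space κ) ℓ} → ContainsClosedCopyOf κ U A →
                ¬ (Σ[ B ∈ Pred (Space κ) ℓ ] Kκ κ B × A ⊆ B)
    copy⇒¬⊆Kκ (C , closed-C , C⊆A , h , h-continuous , _)
              (B , (Part , compact , B⊆Parts , _) , A⊆B) =
      let x̂ = Inverse.from h (y , [ tt ])
          x∈C = ∈-Subtype x̂
          α , x∈Part = B⊆Parts (A⊆B (C⊆A x∈C))
          β , β∈J , ε , constant = proj₂ (proj₂ (subcover α)) x∈Part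
          yα≡β = trans (cong (λ w → value w α) (sym (Inverse.strictlyInverseˡ h (y , [ tt ]))))
                   (constant x̂ λ _ → refl)
      in proj₂ (missed α) (subst (proj₁ (subcover α)) (sym yα≡β) β∈J)
      where
      -- Coordinate α of `h` is defined on `C` only. Requiring it to be constantly β on `C` near `x`
      -- gives a set open in the whole space.
      V : K → K → Pred (Space κ) ℓ
      V α β x = ∃[ ε ] ∀ (x′ : Subtype C) → x ≈[ ε ] value x′ → value (Inverse.to h x′) α ≡ β

      V-open : ∀ α β → Open κ (V α β)
      V-open α β = local⇒open λ (ε , constant) →
        ε , λ x≈y → ε , λ x′ y≈x′ → constant x′ (≈-trans x≈y y≈x′)

      V-covers : ∀ α x → ∃[ β ] x ∈ V α β
      V-covers α x = case em {P = x ∈ C} of λ where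
        (yes x∈C) →
          let δ , α<δ = no-greatest α
              ε , hx≈ = continuous⇒locallyDetermined C U h-continuous (x , [ x∈C ]) δ
          in _ , ε , λ x′ x≈x′ → sym (hx≈ x′ x≈x′ α<δ)
        (no x∉C) →
          let ε , ⊆∁C = open⇒local closed-C x∉C
          -- Near a point outside `C` the condition is vacuous, so any value will do.
          in 0# , ε , λ x′ x≈x′ → ⊥-elim (⊆∁C x≈x′ (∈-Subtype x′))

      subcover : ∀ α → Σ[ J ∈ Pred K ℓ ] (Subtype J ≺ K) ×
                       Part α ⊆ (λ x → ∃[ β ] β ∈ J × x ∈ V α β)
      subcover α = compact α K (V α) (V-open α) λ {x} _ → V-covers α x

      missed : ∀ α → ∃[ β ] ¬ β ∈ proj₁ (subcover α)
      missed α = ¬∀⇒∃¬ λ all → proj₂ (proj₁ (proj₂ (subcover α)))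
        (mk↣ {to = λ β → β , [ all β ]} (cong value))

      y : Space κ
      y α = proj₁ (missed α)

    -- The constant functions already supply κ many points.
    copy⇒κ↣ : ∀ {A : Pred (Space κ) ℓ} → ContainsClosedCopyOf κ U A → K ↣ Subtype A
    copy⇒κ↣ (C , _ , C⊆A , h , _) =
      mk↣ {to = λ α → let x = x̂ α in value x , [ C⊆A (∈-Subtype x) ]} λ {α} {β} e →
        cong (λ w → value w 0#) (trans (sym (Inverse.strictlyInverseˡ h _))
          (trans (cong (Inverse.to h) (value-injective {v = x̂ α} {w = x̂ β} (cong value e)))
                 (Inverse.strictlyInverseˡ h _)))
      where
      x̂ : K → Subtype C
      x̂ α = Inverse.from h ((λ _ → α) , [ tt ])

    -- Consequences of the perfect set property

    module _ (¬weaklyCompact : ¬ WeaklyCompact κ) (A : Pred (Space κ) ℓ)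
             (perfect : PerfectSetProperty κ A) where

      -- Since κ is uncountable, failure of weak compactness means failure of the partition
      -- property, which supplies the colouring for the embedding into ^κ2.
      large⇒copy : ¬ (Subtype A ↣ K) → ContainsClosedCopyOf κ U A
      large⇒copy ¬A↣K = case perfect of λ where
        (inj₁ A↣K) → ⊥-elim (¬A↣K A↣K)
        (inj₂ copy) →
          let c , ¬homogeneous = ¬∀⇒∃¬ λ partition → ¬weaklyCompact (uncountable , partition)
          in closedEmbedding⇒copy (cantor-closedEmbedding c λ H K↔H i homogeneous →
               ¬homogeneous (H , K↔H , i , homogeneous)) copy

      ¬⊆Kκ⇒large : ¬ (Σ[ B ∈ Pred (Space κ) ℓ ] Kκ κ B × A ⊆ B) → ¬ (Subtype A ↣ K)
      ¬⊆Kκ⇒large ¬⊆Kκ A↣K = ¬⊆Kκ (A , ≤κ⇒Kκ A↣K , λ x∈A → x∈A)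

      strongHurewiczDichotomy : StrongHurewiczDichotomy κ A
      strongHurewiczDichotomy = case em {P = Subtype A ↣ K} of λ where
        (yes A↣K) → inj₁ (≤κ⇒Kκ A↣K)
        (no ¬A↣K) → inj₂ (large⇒copy ¬A↣K)

proposition2p7 : Classical →
    ∀ {ℓ : Level} (κ : Cardinal ℓ) →
    Uncountable κ →
    κ≡κ^<κ κ →
    ¬ WeaklyCompact κ →
    ∀ (A : Pred (Space κ) ℓ) →
    PerfectSetProperty κ A →
    ( (ContainsClosedCopyOf κ U A ⇔ (¬ (Σ[ B ∈ Pred (Space κ) ℓ ] Kκ κ B × A ⊆ B)))
    × ((¬ (Σ[ B ∈ Pred (Space κ) ℓ ] Kκ κ B × A ⊆ B)) ⇔ (Cardinal.Carrier κ ≺ Subtype A)) )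
    × StrongHurewiczDichotomy κ A
proposition2p7 classical κ uncountable power ¬weaklyCompact A perfect =
  ( mk⇔ (copy⇒¬⊆Kκ classical κ uncountable power) (copy ∘ large)
  -- The step from (2) to (3) passes through (1), because `≺` also asks for an injection of κ into
  -- `A`.
  , mk⇔ (λ ¬⊆Kκ → copy⇒κ↣ classical κ uncountable power (copy (large ¬⊆Kκ)) , large ¬⊆Kκ)
        (copy⇒¬⊆Kκ classical κ uncountable power ∘ copy ∘ proj₂) )
  , strongHurewiczDichotomy classical κ uncountable power ¬weaklyCompact A perfect
  where
  large = ¬⊆Kκ⇒large classical κ uncountable power ¬weaklyCompact A perfect
  copy = large⇒copy classical κ uncountable power ¬weaklyCompact A perfect
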